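{- In the modal logic $\mathrm{SN}$ (defined in the context): if $\vdash B\leftrightarrow C$ then $\vdash A[p/B]\leftrightarrow A[p/C]$ for every formula $A$ and atom $p$, where $A[p/B]$ denotes the result of substituting $B$ for every occurrence of $p$ in $A$.
   Context: $\mathrm{SN}$ is the logic whose formulas are built from propositional atoms $p$, constants $\top,\bot$ and a propositional constant $t$, using $\neg,\wedge,\vee,\to$ and a unary connective $N$ (which may be applied to any formula and iterated). Its theorems ($\vdash A$) are generated by: all classical tautologies; the axioms (K) $N(A\wedge B)\leftrightarrow NA\vee NB$; (F) $\neg NA\leftrightarrow N\neg A$; (C) $A\to NNA$; (A) $t\to(p\to N\neg p)$ for atoms $p$; (T) $t\leftrightarrow Nt$; and the rules modus ponens and (N): from $A$ infer $N\neg A$. -}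

module Defs where

open import Data.Bool.Base as Bool using (Bool; true; false; not; if_then_else_)
open import Level using (Level)
open import Relation.Binary.Definitions using (DecidableEquality)
open import Relation.Binary.PropositionalEquality using (_≡_)
open import Relation.Nullary.Decidable using (⌊_⌋)

infix  9 ¬_ N_
infixr 7 _∧_
infixr 6 _∨_
infixr 5 _⇒_
infix  4 _⇔_
infix  2 ⊢_

data Formula {a : Level} (Atom : Set a) : Set a where
  atom        : Atom → Formula Atom
  ⊤ ⊥ t       : Formula Atom
  ¬_ N_       : Formula Atom → Formula Atom
  _∧_ _∨_ _⇒_ : Formula Atom → Formula Atom → Formula Atom

_⇔_ : {a : Level} {Atom : Set a} → Formula Atom → Formula Atom → Formula Atom
A ⇔ B = (A ⇒ B) ∧ (B ⇒ A)

-- Atoms, t and every formula of the form N A count as propositional variables,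
-- so v is consulted only at such formulas.
eval : {a : Level} {Atom : Set a} → (Formula Atom → Bool) → Formula Atom → Bool
eval v (atom p) = v (atom p)
eval v ⊤        = true
eval v ⊥        = false
eval v t        = v t
eval v (¬ A)    = not (eval v A)
eval v (N A)    = v (N A)
eval v (A ∧ B)  = eval v A Bool.∧ eval v B
eval v (A ∨ B)  = eval v A Bool.∨ eval v B
eval v (A ⇒ B)  = not (eval v A) Bool.∨ eval v B

-- Classical tautologies of the full language, i.e. substitution instances of
-- tautologies of the N-free language.
Tautology : {a : Level} {Atom : Set a} → Formula Atom → Set a
Tautology A = ∀ v → eval v A ≡ true

data ⊢_ {a : Level} {Atom : Set a} : Formula Atom → Set a where
  taut  : ∀ {A} → Tautology A → ⊢ A
  axK   : ∀ A B → ⊢ N (A ∧ B) ⇔ N A ∨ N B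
  axF   : ∀ A → ⊢ ¬ N A ⇔ N ¬ A
  axC   : ∀ A → ⊢ A ⇒ N N A
  axA   : ∀ p → ⊢ t ⇒ (atom p ⇒ N ¬ atom p)
  axT   : ⊢ t ⇔ N t
  mp    : ∀ {A B} → ⊢ A ⇒ B → ⊢ A → ⊢ B
  ruleN : ∀ {A} → ⊢ A → ⊢ N ¬ A

module Substitution {a : Level} {Atom : Set a} (_≟_ : DecidableEquality Atom) where

  infix 10 _[_/_]

  -- A [ p / B ] puts B in place of p.
  _[_/_] : Formula Atom → Atom → Formula Atom → Formula Atom
  atom q  [ p / B ] = if ⌊ q ≟ p ⌋ then B else atom q
  ⊤       [ p / B ] = ⊤
  ⊥       [ p / B ] = ⊥
  t       [ p / B ] = t
  (¬ A)   [ p / B ] = ¬ (A [ p / B ])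
  (N A)   [ p / B ] = N (A [ p / B ])
  (A ∧ C) [ p / B ] = A [ p / B ] ∧ C [ p / B ]
  (A ∨ C) [ p / B ] = A [ p / B ] ∨ C [ p / B ]
  (A ⇒ C) [ p / B ] = A [ p / B ] ⇒ C [ p / B ]

{-# OPTIONS --safe #-}
-- Only the congruence of N is not propositional. By (N) and (F), N X is a
-- theorem whenever X is refutable. If A ⇒ B is a theorem, then A ∧ ¬ B is
-- refutable, so N (A ∧ ¬ B) is a theorem; by (K) and (F) it amounts to
-- N A ∨ ¬ N B. Hence N reverses provable implications.
module Submission where

open import Defs
open import Data.Bool.Base as Bool using (Bool; true; false; not)
open import Level using (Level)
open import Relation.Binary.Definitions using (DecidableEquality)
open import Relation.Binary.PropositionalEquality using (_≡_; refl; sym; trans; cong; cong₂)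
open import Relation.Nullary.Decidable using (yes; no)

private
  variable
    a : Level
    Atom : Set a
    A B C D X : Formula Atom

implies-true⁺ : ∀ x {y} → (x ≡ true → y ≡ true) → not x Bool.∨ y ≡ true
implies-true⁺ true  f = f refl
implies-true⁺ false f = refl

-- The Boolean expression is what `eval v (A ⇔ B)` unfolds to. Reading it as an equality of truth
-- values reduces the congruence of a connective to `cong` or `cong₂` on its truth function.
iff-true⁺ : ∀ {x y} → x ≡ y → (not x Bool.∨ y) Bool.∧ (not y Bool.∨ x) ≡ true
iff-true⁺ {true}  refl = refl
iff-true⁺ {false} refl = refl

iff-true⁻ : ∀ x y → (not x Bool.∨ y) Bool.∧ (not y Bool.∨ x) ≡ true → x ≡ y
iff-true⁻ true  true  _ = refl
iff-true⁻ false false _ = refl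

-- Semantic entailment makes `A ⇒ B` a tautology, so every purely propositional step below becomes a
-- check of truth values, with formulas `N X` opaque to `v`.
consequence : (∀ v → eval v A ≡ true → eval v B ≡ true) → ⊢ A → ⊢ B
consequence {A = A} A⊨B = mp (taut λ v → implies-true⁺ (eval v A) (A⊨B v))

consequence₂ : (∀ v → eval v A ≡ true → eval v B ≡ true → eval v C ≡ true) →
               ⊢ A → ⊢ B → ⊢ C
consequence₂ {A = A} {B = B} AB⊨C ⊢A =
  mp (consequence (λ v eA → implies-true⁺ (eval v B) (AB⊨C v eA)) ⊢A)

eval-⇔⁻ : ∀ v (A B : Formula Atom) → eval v (A ⇔ B) ≡ true → eval v A ≡ eval v B
eval-⇔⁻ v A B = iff-true⁻ (eval v A) (eval v B)

⇔-refl : ⊢ A ⇔ A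
⇔-refl {A = A} = taut λ v → iff-true⁺ {eval v A} refl

⇔-sym : ⊢ A ⇔ B → ⊢ B ⇔ A
⇔-sym {A = A} {B = B} = consequence λ v e → iff-true⁺ (sym (eval-⇔⁻ v A B e))

⇔-trans : ⊢ A ⇔ B → ⊢ B ⇔ C → ⊢ A ⇔ C
⇔-trans {A = A} {B = B} {C = C} = consequence₂ λ v e f →
  iff-true⁺ (trans (eval-⇔⁻ v A B e) (eval-⇔⁻ v B C f))

⇔-mp : ⊢ A ⇔ B → ⊢ A → ⊢ B
⇔-mp {A = A} {B = B} = consequence₂ λ v e eA → trans (sym (eval-⇔⁻ v A B e)) eA

¬-cong : ⊢ A ⇔ B → ⊢ ¬ A ⇔ ¬ B
¬-cong {A = A} {B = B} = consequence λ v e → iff-true⁺ (cong not (eval-⇔⁻ v A B e))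

∧-cong : ⊢ A ⇔ B → ⊢ C ⇔ D → ⊢ A ∧ C ⇔ B ∧ D
∧-cong {A = A} {B = B} {C = C} {D = D} = consequence₂ λ v e f →
  iff-true⁺ (cong₂ Bool._∧_ (eval-⇔⁻ v A B e) (eval-⇔⁻ v C D f))

∨-cong : ⊢ A ⇔ B → ⊢ C ⇔ D → ⊢ A ∨ C ⇔ B ∨ D
∨-cong {A = A} {B = B} {C = C} {D = D} = consequence₂ λ v e f →
  iff-true⁺ (cong₂ Bool._∨_ (eval-⇔⁻ v A B e) (eval-⇔⁻ v C D f))

⇒-cong : ⊢ A ⇔ B → ⊢ C ⇔ D → ⊢ (A ⇒ C) ⇔ (B ⇒ D)
⇒-cong {A = A} {B = B} {C = C} {D = D} = consequence₂ λ v e f →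
  iff-true⁺ (cong₂ (λ x y → not x Bool.∨ y) (eval-⇔⁻ v A B e) (eval-⇔⁻ v C D f))

⇔-intro : ⊢ A ⇒ B → ⊢ B ⇒ A → ⊢ A ⇔ B
⇔-intro = consequence₂ λ v e f → cong₂ Bool._∧_ e f

⇔-to : ⊢ A ⇔ B → ⊢ A ⇒ B
⇔-to {A = A} {B = B} = consequence λ v e →
  implies-true⁺ (eval v A) (trans (sym (eval-⇔⁻ v A B e)))

¬¬-elim : ⊢ ¬ ¬ A → ⊢ A
¬¬-elim {A = A} = consequence λ v → lemma (eval v A)
  where
  lemma : ∀ x → not (not x) ≡ true → x ≡ true
  lemma true _ = refl

-- The refuted formula is a conjunction, the shape under `N` to which `axK` applies.
⇒-refute : ⊢ A ⇒ B → ⊢ ¬ (A ∧ ¬ B)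
⇒-refute {A = A} {B = B} = consequence λ v → lemma (eval v A) (eval v B)
  where
  lemma : ∀ x y → not x Bool.∨ y ≡ true → not (x Bool.∧ not y) ≡ true
  lemma true  true _ = refl
  lemma false _    _ = refl

∨¬-to-⇒ : ⊢ A ∨ ¬ B → ⊢ B ⇒ A
∨¬-to-⇒ {A = A} {B = B} = consequence λ v → lemma (eval v A) (eval v B)
  where
  lemma : ∀ x y → x Bool.∨ not y ≡ true → not y Bool.∨ x ≡ true
  lemma true  true  _ = refl
  lemma _     false _ = refl

N-of-refutable : ⊢ ¬ X → ⊢ N X
N-of-refutable {X = X} ⊢¬X =
  -- `ruleN` gives `N ¬ ¬ X`. Congruence under `N` is not yet available to cancel the double
  -- negation there, so `axF`, used at `¬ X` and then at `X`, moves both negations outside: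
  -- `¬ N ¬ X`, then `¬ ¬ N X`.
  ¬¬-elim (⇔-mp (⇔-trans (⇔-sym (axF (¬ X))) (¬-cong (⇔-sym (axF X)))) (ruleN ⊢¬X))

N-antitone : ⊢ A ⇒ B → ⊢ N B ⇒ N A
N-antitone {A = A} {B = B} ⊢A⇒B =
  ∨¬-to-⇒ (⇔-mp (⇔-trans (axK A (¬ B)) (∨-cong ⇔-refl (⇔-sym (axF B))))
                (N-of-refutable (⇒-refute ⊢A⇒B)))

N-cong : ⊢ A ⇔ B → ⊢ N A ⇔ N B
-- Since `N` reverses implications, each direction comes from the opposite half of `A ⇔ B`.
N-cong ⊢A⇔B = ⇔-intro (N-antitone (⇔-to (⇔-sym ⊢A⇔B))) (N-antitone (⇔-to ⊢A⇔B))

theorem33 : {a : Level} {Atom : Set a} (_≟_ : DecidableEquality Atom) →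
    let open Substitution _≟_ in
    (B C : Formula Atom) → ⊢ B ⇔ C →
    (A : Formula Atom) (p : Atom) → ⊢ A [ p / B ] ⇔ A [ p / C ]
theorem33 _≟_ B C ⊢B⇔C A p = replace A
  where
  open Substitution _≟_

  replace : ∀ A → ⊢ A [ p / B ] ⇔ A [ p / C ]
  -- The case split resolves the conditional in both substitutions at once: the goal becomes `B ⇔ C`
  -- or `atom q ⇔ atom q`.
  replace (atom q) with q ≟ p
  ... | yes _ = ⊢B⇔C
  ... | no  _ = ⇔-refl
  replace ⊤        = ⇔-refl
  replace ⊥        = ⇔-refl
  replace t        = ⇔-refl
  replace (¬ A)    = ¬-cong (replace A)
  replace (N A)    = N-cong (replace A)
  replace (A ∧ D)  = ∧-cong (replace A) (replace D)
  replace (A ∨ D)  = ∨-cong (replace A) (replace D)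
  replace (A ⇒ D)  = ⇒-cong (replace A) (replace D)
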